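{- Let $F_0$ be a weighted QF-NIA formula consisting of a set $H_0$ of hard clauses and a set $S_0=\{[D_1,\Omega_1],\dots,[D_m,\Omega_m]\}$ of soft clauses with positive natural-number weights. Consider the following procedure $\mathrm{SolveMaxSMT}(F_0)$. Initialization. Choose artificial bounds $B$ sufficient to linearize $F_0$. Linearize to obtain linear hard clauses $H$ and linear soft clauses $S$ (see context). Set $\mathit{bsf}:=\mathrm{undef}$ and $\mathit{msc}:=\infty$. Loop. Repeat until a time limit is exceeded. Call a threshold Max-SMT(QF-LIA) oracle on $(H,S,B,\mathit{msc})$. This oracle returns $\mathrm{Unsat}$ if there is no integer model $\alpha$ of $H$ with $\mathrm{cost}_S(\alpha)\le\mathit{msc}$. Otherwise it returns a model $M$ of $H$ with $\mathrm{cost}_S(M)\le\mathit{msc}$ minimizing the pair $(\mathrm{cost}_B(M),\mathrm{cost}_S(M))$ lexicographically among all such models. Act on the result as follows. - If the oracle returns $\mathrm{Unsat}$: return $\langle\mathrm{Unsat},\mathrm{undef}\rangle$ if $\mathit{bsf}=\mathrm{undef}$, and $\langle\mathrm{Sat},\mathit{bsf}\rangle$ otherwise. - Else, if $\mathrm{cost}_B(M)=0$: set $\mathit{bsf}:=M$ and $\mathit{msc}:=\mathrm{cost}_S(M)-1$. - Else: choose a nonempty set of bounds of $B$ violated by $M$. Replace each such $V\ge L$ by $V\ge M(V)$ and each such $V\le U$ by $V\le M(V)$. Add to $H$ the case-splitting clauses $V=K\rightarrow v_Q=Q[V:=K]$ for every value $K$ newly included in the domain of $V$ and every monomial $Q$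 linearized using $V$. Timeout. If the time limit is exceeded, return $\langle\mathrm{Unknown},\mathrm{undef}\rangle$. Then: (i) if $\mathrm{SolveMaxSMT}(F_0)$ returns $\langle\mathrm{Sat},M\rangle$, then $H_0$ is satisfiable and $M$ (restricted to the variables of $F_0$) is a model of $H_0$ that minimizes the sum of the weights of the clauses of $S_0$ it falsifies, among all integer models of $H_0$; (ii) if $\mathrm{SolveMaxSMT}(F_0)$ returns $\langle\mathrm{Unsat},\mathrm{undef}\rangle$, then $H_0$ is unsatisfiable over the integers.
   Context: QF-NIA clauses are disjunctions of polynomial inequalities with integer coefficients over integer-valued variables. Artificial bounds are a finite set $B$ of constraints $V\ge L$ or $V\le U$ ($L,U\in\mathbb{Z}$). Linearization. While some non-linear monomial $Q$ occurs, pick a variable $V$ of $Q$ having both a lower bound $l$ and an upper bound $u$ (from $F_0$ or $B$). Introduce a fresh integer variable $v_Q$ and replace every occurrence of $Q$ by $v_Q$. Add, for each integer $K$ with $l\le K\le u$, the case-splitting clause $V=K\rightarrow v_Q=Q[V:=K]$, where $Q[V:=K]$ is $Q$ with $V$ evaluated at $K$. New non-linear monomials are processed in the same way. Linear clauses. $H$ consists of the clauses of $H_0$ with monomials replaced by their fresh variables, together with all case-splitting clauses. $S$ consists of the soft clauses $[D_i',\Omega_i]$, where $D_i'$ is $D_i$ with monomials replaced. Costs. For an assignment $\alpha$, the bound cost $\mathrm{cost}_B(\alpha)$ is the number of bounds of $B$ (each treated as a soft clause of weight $1$) that $\alpha$ violates. The soft cost $\mathrm{cost}_S(\alpha)$ is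 $\sum\{\Omega : [D,\Omega]\in S,\ \alpha\not\models D\}$. -}

module Defs where

open import Data.Fin using (Fin; zero; suc)
import Data.Fin.Properties as Fin
open import Data.Integer as ℤ using (ℤ; +_; 0ℤ; 1ℤ)
import Data.Integer.Properties as ℤ
open import Data.List using (List; []; _∷_; _++_; map; filter; concatMap; mapMaybe; deduplicate; length; upTo)
open import Data.Nat.ListAction using (sum)
open import Data.List.Membership.Propositional using (_∈_; _∉_)
import Data.List.Membership.DecPropositional as DecMembership
open import Data.List.Relation.Unary.All using (All; all?)
open import Data.List.Relation.Unary.Any using (Any; any?)
open import Data.Maybe using (Maybe; just; nothing)
open import Data.Nat as ℕ using (ℕ)
open import Data.Product using (∃; ∃-syntax; _×_; _,_; proj₂)
open import Data.Product.Relation.Binary.Lex.Strict using (×-Lex)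
open import Data.Sum using (_⊎_; inj₁; inj₂; [_,_])
open import Data.Unit using (⊤)
open import Data.Vec as Vec using (Vec; []; _∷_; lookup; _[_]≔_)
import Data.Vec.Properties as Vec
open import Function using (_∘_; _⇔_)
open import Relation.Binary.Construct.Closure.ReflexiveTransitive using (Star)
open import Relation.Binary.Definitions using (DecidableEquality)
open import Relation.Binary.PropositionalEquality using (_≡_; _≢_; refl)
open import Relation.Nullary using (¬_; Dec; yes; no; ¬?)
open import Relation.Nullary.Decidable using (_×-dec_)

------------------------------------------------------------------------
-- Polynomials, clauses and costs.
--
-- The syntax is generic in the type A of the things that carry a
-- coefficient: A = Monomial n for QF-NIA input formulas, and
-- A = Atom n (monomials and fresh variables) during linearization.

Polynomial : Set → Set
Polynomial A = List (ℤ × A)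

data Relop : Set where
  `≤ `< `≥ `> : Relop

record Literal (A : Set) : Set where
  constructor lit
  field
    lhs   : Polynomial A
    relop : Relop
    rhs   : Polynomial A
open Literal public

Clause : Set → Set
Clause A = List (Literal A)

record SoftClause (A : Set) : Set where
  constructor soft[_,_,_]
  field
    clause          : Clause A
    weight          : ℕ
    weight-positive : 0 ℕ.< weight
open SoftClause public

mapPolynomial : {A B : Set} → (A → B) → Polynomial A → Polynomial B
mapPolynomial f = map (λ (c , a) → c , f a)

mapLiteral : {A B : Set} → (A → B) → Literal A → Literal B
mapLiteral f (lit p r q) = lit (mapPolynomial f p) r (mapPolynomial f q)

mapClause : {A B : Set} → (A → B) → Clause A → Clause B
mapClause f = map (mapLiteral f)

mapSoft : {A B : Set} → (A → B) → SoftClause A → SoftClause B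
mapSoft f soft[ D , Ω , pos ] = soft[ mapClause f D , Ω , pos ]

module Semantics {A : Set} (value : A → ℤ) where

  evalPolynomial : Polynomial A → ℤ
  evalPolynomial []            = 0ℤ
  evalPolynomial ((c , a) ∷ p) = c ℤ.* value a ℤ.+ evalPolynomial p

  SatRelop : Relop → ℤ → ℤ → Set
  SatRelop `≤ x y = x ℤ.≤ y
  SatRelop `< x y = x ℤ.< y
  SatRelop `≥ x y = x ℤ.≥ y
  SatRelop `> x y = x ℤ.> y

  satRelop? : ∀ r x y → Dec (SatRelop r x y)
  satRelop? `≤ x y = x ℤ.≤? y
  satRelop? `< x y = x ℤ.<? y
  satRelop? `≥ x y = y ℤ.≤? x
  satRelop? `> x y = y ℤ.<? x

  SatLiteral : Literal A → Set
  SatLiteral (lit p r q) = SatRelop r (evalPolynomial p) (evalPolynomial q)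

  satLiteral? : ∀ ℓ → Dec (SatLiteral ℓ)
  satLiteral? (lit p r q) = satRelop? r (evalPolynomial p) (evalPolynomial q)

  SatClause : Clause A → Set
  SatClause = Any SatLiteral

  satClause? : ∀ C → Dec (SatClause C)
  satClause? = any? satLiteral?

  SatAll : List (Clause A) → Set
  SatAll = All SatClause

  softCost : List (SoftClause A) → ℕ
  softCost S = sum (map weight (filter (¬? ∘ satClause? ∘ clause) S))

------------------------------------------------------------------------
-- Weighted QF-NIA formulas over n integer variables.

Assignment : ℕ → Set
Assignment n = Fin n → ℤ

-- Exponent vectors, so that x·y and y·x are the same monomial; the zero
-- vector is the constant monomial 1.
Monomial : ℕ → Set
Monomial n = Vec ℕ n

evalMonomial : ∀ {n} → Assignment n → Monomial n → ℤ
evalMonomial α []       = 1ℤ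
evalMonomial α (e ∷ es) = α zero ℤ.^ e ℤ.* evalMonomial (α ∘ suc) es

_≟ᴹ_ : ∀ {n} → DecidableEquality (Monomial n)
_≟ᴹ_ = Vec.≡-dec ℕ._≟_

oneᴹ : ∀ {n} → Monomial n
oneᴹ = Vec.replicate _ 0

varᴹ : ∀ {n} → Fin n → Monomial n
varᴹ V = oneᴹ [ V ]≔ 1

NonLinear : ∀ {n} → Monomial n → Set
NonLinear Q = 2 ℕ.≤ Vec.sum Q

record Formula (n : ℕ) : Set where
  field
    hard₀ : List (Clause (Monomial n))
    soft₀ : List (SoftClause (Monomial n))
open Formula public

Models : ∀ {n} → Assignment n → Formula n → Set
Models α F = Semantics.SatAll (evalMonomial α) (hard₀ F)

Satisfiable : ∀ {n} → Formula n → Set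
Satisfiable F = ∃[ α ] Models α F

cost : ∀ {n} → Formula n → Assignment n → ℕ
cost F α = Semantics.softCost (evalMonomial α) (soft₀ F)

------------------------------------------------------------------------
-- Bounds.

data Bound (n : ℕ) : Set where
  lower : Fin n → ℤ → Bound n
  upper : Fin n → ℤ → Bound n

_≟ᴮ_ : ∀ {n} → DecidableEquality (Bound n)
lower V L ≟ᴮ lower W M with V Fin.≟ W | L ℤ.≟ M
... | yes refl | yes refl = yes refl
... | no V≢W   | _        = no λ { refl → V≢W refl }
... | yes _    | no L≢M   = no λ { refl → L≢M refl }
lower V L ≟ᴮ upper W M = no λ ()
upper V L ≟ᴮ lower W M = no λ ()
upper V L ≟ᴮ upper W M with V Fin.≟ W | L ℤ.≟ M
... | yes refl | yes refl = yes refl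
... | no V≢W   | _        = no λ { refl → V≢W refl }
... | yes _    | no L≢M   = no λ { refl → L≢M refl }

SatBound : ∀ {n} → Assignment n → Bound n → Set
SatBound α (lower V L) = α V ℤ.≥ L
SatBound α (upper V U) = α V ℤ.≤ U

satBound? : ∀ {n} (α : Assignment n) b → Dec (SatBound α b)
satBound? α (lower V L) = L ℤ.≤? α V
satBound? α (upper V U) = α V ℤ.≤? U

-- A list B stands for the set of its elements, so repetitions are not
-- counted twice.
boundCost : ∀ {n} → List (Bound n) → Assignment n → ℕ
boundCost B α = length (filter (¬? ∘ satBound? α) (deduplicate _≟ᴮ_ B))

range : ℤ → ℤ → List ℤ
range l u with l ℤ.≤? u
... | yes _ = map (λ i → l ℤ.+ + i) (upTo (ℕ.suc ℤ.∣ u ℤ.- l ∣))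
... | no  _ = []

lowers : ∀ {n} → Fin n → List (Bound n) → List ℤ
lowers {n} V = mapMaybe bound
  where
  bound : Bound n → Maybe ℤ
  bound (upper _ _) = nothing
  bound (lower W L) with V Fin.≟ W
  ... | yes _ = just L
  ... | no  _ = nothing

uppers : ∀ {n} → Fin n → List (Bound n) → List ℤ
uppers {n} V = mapMaybe bound
  where
  bound : Bound n → Maybe ℤ
  bound (lower _ _) = nothing
  bound (upper W U) with V Fin.≟ W
  ... | yes _ = just U
  ... | no  _ = nothing

-- The integers between all lower and all upper bounds on V in bs. This is
-- only meaningful if V has a bound of either kind, which holds for every
-- variable used to linearize a monomial.
domain : ∀ {n} → List (Bound n) → Fin n → List ℤ
domain bs V = filter inside? (candidates (lowers V bs) (uppers V bs))
  where
  inside? : ∀ K → Dec (All (ℤ._≤ K) (lowers V bs) × All (K ℤ.≤_) (uppers V bs))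
  inside? K = all? (ℤ._≤? K) (lowers V bs) ×-dec all? (K ℤ.≤?_) (uppers V bs)
  candidates : List ℤ → List ℤ → List ℤ
  candidates (l ∷ _) (u ∷ _) = range l u
  candidates _       _       = []

------------------------------------------------------------------------
-- Linearization.

-- What carries a coefficient during linearization: a monomial over the
-- original variables, or a fresh variable. Whole monomials are replaced by
-- fresh variables, so these never occur inside a larger monomial.
Atom : ℕ → Set
Atom n = Monomial n ⊎ ℕ

-- The original variables together with the fresh ones.
Var : ℕ → Set
Var n = Fin n ⊎ ℕ

Assignment⁺ : ℕ → Set
Assignment⁺ n = Var n → ℤ

restrict : ∀ {n} → Assignment⁺ n → Assignment n
restrict α = α ∘ inj₁

evalAtom : ∀ {n} → Assignment⁺ n → Atom n → ℤ
evalAtom α = [ evalMonomial (restrict α) , α ∘ inj₂ ]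

-- The monomial Q has been linearized using the variable V, and is
-- represented by the fresh variable v.
record Entry (n : ℕ) : Set where
  constructor entry
  field
    Q : Monomial n
    V : Fin n
    v : ℕ

rename : ∀ {n} → List (Entry n) → Atom n → Atom n
rename T                 (inj₂ v)  = inj₂ v
rename []                (inj₁ Q)  = inj₁ Q
rename (entry Q′ _ v ∷ T) (inj₁ Q) with Q ≟ᴹ Q′
... | yes _ = inj₂ v
... | no  _ = rename T (inj₁ Q)

-- Q[V:=K]; if this is 0 then no monomial occurs in it.
evaluateAt : ∀ {n} → Monomial n → Fin n → ℤ → Polynomial (Atom n)
evaluateAt Q V K with K ℤ.^ lookup Q V
... | + 0 = []
... | c   = (c , inj₁ (Q [ V ]≔ 0)) ∷ []

-- V = K → v = Q[V:=K] as disjunctions of inequalities, namely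
-- V < K ∨ V > K ∨ v ≤ Q[V:=K] and V < K ∨ V > K ∨ v ≥ Q[V:=K].
-- Monomials of Q[V:=K] that are already linearized (those in T) are
-- replaced by their fresh variables.
caseSplit : ∀ {n} → List (Entry n) → Entry n → ℤ → List (Clause (Atom n))
caseSplit T (entry Q V v) K = map (mapClause (rename T)) (split `≤ ∷ split `≥ ∷ [])
  where
  var   = (1ℤ , inj₁ (varᴹ V)) ∷ []
  const = (K , inj₁ oneᴹ) ∷ []
  split : Relop → Clause (Atom _)
  split r = lit var `< const ∷ lit var `> const
          ∷ lit ((1ℤ , inj₂ v) ∷ []) r (evaluateAt Q V K) ∷ []

record Clauses (n : ℕ) : Set where
  constructor ⟨_,_,_⟩
  field
    table : List (Entry n)
    hard  : List (Clause (Atom n))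
    soft  : List (SoftClause (Atom n))
open Clauses public

initial : ∀ {n} → Formula n → Clauses n
initial F = ⟨ [] , map (mapClause inj₁) (hard₀ F) , map (mapSoft inj₁) (soft₀ F) ⟩

OccursInLiteral : {A : Set} → A → Literal A → Set
OccursInLiteral a ℓ = a ∈ map proj₂ (lhs ℓ) ⊎ a ∈ map proj₂ (rhs ℓ)

Occurs : ∀ {n} → Monomial n → Clauses n → Set
Occurs Q s = Any (Any (OccursInLiteral (inj₁ Q))) (hard s)
           ⊎ Any (Any (OccursInLiteral (inj₁ Q)) ∘ clause) (soft s)

-- All fresh variables introduced so far are those of the table.
Fresh : ∀ {n} → ℕ → Clauses n → Set
Fresh v s = v ∉ map Entry.v (table s)

-- One linearization step, with the bounds bs available.
data _⊢_⟶_ {n} (bs : List (Bound n)) : Clauses n → Clauses n → Set where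
  linearize : ∀ {s} Q V l u v →
    NonLinear Q → Occurs Q s → 0 ℕ.< lookup Q V →
    lower V l ∈ bs → upper V u ∈ bs → Fresh v s →
    let e = entry Q V v
        T = e ∷ table s
    in bs ⊢ s ⟶ ⟨ T
                , map (mapClause (rename (e ∷ []))) (hard s)
                  ++ concatMap (caseSplit T e) (range l u)
                , map (mapSoft (rename (e ∷ []))) (soft s) ⟩

Linearizes : ∀ {n} → List (Bound n) → Clauses n → Clauses n → Set
Linearizes bs s t = Star (bs ⊢_⟶_) s t × (∀ Q → NonLinear Q → ¬ Occurs Q t)

-- b is a bound coming from F: F has a hard unit clause whose literal is
-- linear and says exactly b (such as V > 2 or 2V ≥ 5 for the bound V ≥ 3).
BoundOf : ∀ {n} → Formula n → Bound n → Set
BoundOf F b = ∃[ ℓ ] (ℓ ∷ []) ∈ hard₀ F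
  × (∀ Q → NonLinear Q → ¬ OccursInLiteral Q ℓ)
  × (∀ α → Semantics.SatLiteral (evalMonomial α) ℓ ⇔ SatBound α b)

------------------------------------------------------------------------
-- The threshold Max-SMT(QF-LIA) oracle.

-- Thresholds are integers, as cost - 1 is -1 when the cost is 0.
data Threshold : Set where
  finite : ℤ → Threshold
  ∞      : Threshold

_≤ᵀ_ : ℕ → Threshold → Set
c ≤ᵀ finite z = + c ℤ.≤ z
c ≤ᵀ ∞        = ⊤

cost-S : ∀ {n} → List (SoftClause (Atom n)) → Assignment⁺ n → ℕ
cost-S S α = Semantics.softCost (evalAtom α) S

cost-B : ∀ {n} → List (Bound n) → Assignment⁺ n → ℕ
cost-B B α = boundCost B (restrict α)

data Answer (n : ℕ) : Set where
  unsat : Answer n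
  model : Assignment⁺ n → Answer n

module _ {n} (H : List (Clause (Atom n))) (S : List (SoftClause (Atom n)))
         (B : List (Bound n)) (msc : Threshold) where

  Candidate : Assignment⁺ n → Set
  Candidate α = Semantics.SatAll (evalAtom α) H × cost-S S α ≤ᵀ msc

  OracleReturns : Answer n → Set
  OracleReturns unsat     = ¬ ∃ Candidate
  OracleReturns (model M) = Candidate M × (∀ α → Candidate α →
    ×-Lex _≡_ ℕ._<_ ℕ._≤_ (cost-B B M , cost-S S M) (cost-B B α , cost-S S α))

------------------------------------------------------------------------
-- The procedure.

record State (n : ℕ) : Set where
  constructor state
  field
    clauses : Clauses n
    B       : List (Bound n)
    bsf     : Maybe (Assignment⁺ n)
    msc     : Threshold

Oracle : ∀ {n} → State n → Answer n → Set
Oracle (state cs B bsf msc) = OracleReturns (hard cs) (soft cs) B msc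

-- Replaces the bounds of B that belong to Cs.
relaxBounds : ∀ {n} → Assignment⁺ n → List (Bound n) → List (Bound n) → List (Bound n)
relaxBounds {n} M Cs = map relax
  where
  open DecMembership (_≟ᴮ_ {n}) using (_∈?_)
  moved : Bound n → Bound n
  moved (lower V L) = lower V (M (inj₁ V))
  moved (upper V U) = upper V (M (inj₁ V))
  relax : Bound n → Bound n
  relax b with b ∈? Cs
  ... | yes _ = moved b
  ... | no  _ = b

-- The case-splitting clauses for the values that are in the domain of a
-- variable for the bounds bs′ but not for the bounds bs.
newCaseSplits : ∀ {n} → List (Entry n) → (bs bs′ : List (Bound n)) → List (Clause (Atom n))
newCaseSplits T bs bs′ =
  concatMap (λ e → concatMap (caseSplit T e) (newValues (Entry.V e))) T
  where
  open DecMembership ℤ._≟_ using (_∉?_)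
  newValues : Fin _ → List ℤ
  newValues V = filter (_∉? domain bs V) (domain bs′ V)

-- One iteration of the loop that does not return; B₀ are the bounds that
-- come from the input formula. The final linearization in the relaxation
-- case is for monomials occurring for the first time in the new clauses (for
-- instance if previously the domain of V was {0}, so that Q[V:=0] = 0); it
-- is the identity if there are none.
data _⊢_⇝_ {n} (B₀ : List (Bound n)) : State n → State n → Set where
  improve : ∀ {cs B bsf msc} M →
    Oracle (state cs B bsf msc) (model M) →
    cost-B B M ≡ 0 →
    B₀ ⊢ state cs B bsf msc
       ⇝ state cs B (just M) (finite (+ cost-S (soft cs) M ℤ.- 1ℤ))
  relax : ∀ {cs B bsf msc} M Cs {cs′} →
    Oracle (state cs B bsf msc) (model M) →
    cost-B B M ≢ 0 →
    Cs ≢ [] → All (_∈ B) Cs → All (¬_ ∘ SatBound (restrict M)) Cs →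
    let B′ = relaxBounds M Cs B in
    Linearizes (B₀ ++ B′)
      ⟨ table cs
      , hard cs ++ newCaseSplits (table cs) (B₀ ++ B) (B₀ ++ B′)
      , soft cs ⟩
      cs′ →
    B₀ ⊢ state cs B bsf msc ⇝ state cs′ B′ bsf msc

data Verdict : Set where
  Sat Unsat Unknown : Verdict

Result : ℕ → Set
Result n = Verdict × Maybe (Assignment⁺ n)

-- The time limit is not modelled: the procedure may time out at any point.
data Returns {n} : State n → Result n → Set where
  return-unsat : ∀ {cs B msc} →
    Oracle (state cs B nothing msc) unsat →
    Returns (state cs B nothing msc) (Unsat , nothing)
  return-sat : ∀ {cs B M msc} →
    Oracle (state cs B (just M) msc) unsat →
    Returns (state cs B (just M) msc) (Sat , just M)
  timeout : ∀ {σ} → Returns σ (Unknown , nothing)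

-- Some run of the procedure on F returns r. That B is sufficient to
-- linearize F is the existence of the complete linearization cs.
record SolveMaxSMT {n} (F : Formula n) (r : Result n) : Set where
  field
    B₀         : List (Bound n)
    B₀-bounds  : All (BoundOf F) B₀
    B          : List (Bound n)
    cs         : Clauses n
    linearizes : Linearizes (B₀ ++ B) (initial F) cs
    final      : State n
    loop       : Star (B₀ ⊢_⇝_) (state cs B nothing ∞) final
    returns    : Returns final r

{-# OPTIONS --safe #-}
-- Call an assignment consistent if every fresh variable v_Q has the value of
-- the monomial Q. On consistent assignments the linear clauses and the input
-- formula agree, for the hard clauses as well as for the soft cost. Every model
-- of the input extends to a consistent assignment, so an Unsat answer of the
-- oracle rules out all models of the input within the threshold. Conversely, a
-- model of the linear hard clauses that respects all bounds is consistent: the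
-- case split at the value of V reduces the claim for Q to the claim for
-- Q[V:=K], which has smaller degree.
module Submission where

open import Defs
open import Data.Bool using (if_then_else_)
open import Data.Empty using (⊥-elim)
open import Data.Fin using (Fin; zero; suc)
import Data.Fin.Properties as Fin
open import Data.Integer as ℤ using (ℤ; +_; -[1+_]; 0ℤ; 1ℤ)
import Data.Integer.Properties as ℤ
open import Data.List using (List; []; _∷_; _++_; map; filter; concatMap; length)
open import Data.List.Membership.Propositional using (_∈_)
open import Data.List.Membership.Propositional.Properties using (∈-map⁺; ∈-++⁺ˡ; ∈-++⁺ʳ; ∈-++⁻; ∈-filter⁺; ∈-filter⁻; ∈-upTo⁺; ∈-deduplicate⁺)
import Data.List.Membership.DecPropositional as DecMembership
open import Data.List.Relation.Unary.All as All using (All; []; _∷_)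
import Data.List.Relation.Unary.All.Properties as All
open import Data.List.Relation.Unary.Any using (here; there)
open import Data.Maybe using (Maybe; just; nothing)
open import Data.Nat as ℕ using (ℕ; _≤_; s≤s)
import Data.Nat.Properties as ℕ
open import Data.Product using (∃-syntax; _×_; _,_; proj₁; proj₂)
open import Data.Sum using (_⊎_; inj₁; inj₂; [_,_])
open import Data.Unit using (tt)
open import Data.Vec as Vec using ([]; _∷_; lookup; _[_]≔_)
open import Function using (_∘_; id; _⇔_; mk⇔; Equivalence)
open import Relation.Binary.Construct.Closure.ReflexiveTransitive using (Star; ε; _◅_)
open import Relation.Binary.Definitions using (tri<; tri≈; tri>)
open import Relation.Binary.PropositionalEquality using (_≡_; refl; sym; trans; cong; cong₂; subst; subst₂; module ≡-Reasoning)
open import Relation.Unary using (Decidable)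
open import Relation.Nullary using (¬_; yes; no; ¬?; does)
open import Relation.Nullary.Decidable using (decidable-stable; dec-true; dec-false)

open Equivalence using (to; from)
open Semantics

private variable
  A B : Set
  n : ℕ

-- Semantics under a change of atoms

-- `SatRelop` carries the valuation as a module parameter, so for a variable `r` the two sides are
-- distinct stuck terms. Matching on `r` makes both reduce to the same comparison.
satRelop-cong : ∀ (w : A → ℤ) (w′ : B → ℤ) r {x x′ y y′} → x ≡ x′ → y ≡ y′ →
  SatRelop w r x y → SatRelop w′ r x′ y′
satRelop-cong w w′ `≤ refl refl s = s
satRelop-cong w w′ `< refl refl s = s
satRelop-cong w w′ `≥ refl refl s = s
satRelop-cong w w′ `> refl refl s = s

evalPolynomial-map : ∀ (f : A → B) (w : A → ℤ) (w′ : B → ℤ) p →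
  (∀ a → a ∈ map proj₂ p → w′ (f a) ≡ w a) →
  evalPolynomial w′ (mapPolynomial f p) ≡ evalPolynomial w p
evalPolynomial-map f w w′ []            eq = refl
evalPolynomial-map f w w′ ((c , a) ∷ p) eq =
  cong₂ (λ x y → c ℤ.* x ℤ.+ y) (eq a (here refl))
        (evalPolynomial-map f w w′ p (λ b → eq b ∘ there))

-- Agreement is required only on atoms that occur, because `boundOf-sat` knows the values of linear
-- monomials only.
satLiteral-map : ∀ (f : A → B) (w : A → ℤ) (w′ : B → ℤ) ℓ →
  (∀ a → OccursInLiteral a ℓ → w′ (f a) ≡ w a) →
  SatLiteral w′ (mapLiteral f ℓ) ⇔ SatLiteral w ℓ
satLiteral-map f w w′ (lit p r q) eq =
  mk⇔ (satRelop-cong w′ w r p≡ q≡) (satRelop-cong w w′ r (sym p≡) (sym q≡))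
  where
  p≡ = evalPolynomial-map f w w′ p (λ a → eq a ∘ inj₁)
  q≡ = evalPolynomial-map f w w′ q (λ a → eq a ∘ inj₂)

module _ (f : A → B) (w : A → ℤ) (w′ : B → ℤ) (eq : ∀ a → w′ (f a) ≡ w a) where

  satClause-map : ∀ C → SatClause w′ (mapClause f C) ⇔ SatClause w C
  satClause-map []      = mk⇔ (λ ()) (λ ())
  satClause-map (ℓ ∷ C) = mk⇔
    (λ { (here s) → here (to ℓ⇔ s) ; (there s) → there (to (satClause-map C) s) })
    (λ { (here s) → here (from ℓ⇔ s) ; (there s) → there (from (satClause-map C) s) })
    where ℓ⇔ = satLiteral-map f w w′ ℓ (λ a _ → eq a)

  satAll-map : ∀ Cs → SatAll w′ (map (mapClause f) Cs) ⇔ SatAll w Cs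
  satAll-map Cs = mk⇔
    (All.map (λ {C} → to (satClause-map C)) ∘ All.map⁻)
    (All.map⁺ ∘ All.map (λ {C} → from (satClause-map C)))

  softCost-map : ∀ S → softCost w′ (map (mapSoft f) S) ≡ softCost w S
  softCost-map [] = refl
  softCost-map (soft[ D , Ω , _ ] ∷ S)
    with satClause? w′ (mapClause f D) | satClause? w D
  ... | yes _  | yes _  = softCost-map S
  ... | no _   | no _   = cong (Ω ℕ.+_) (softCost-map S)
  ... | yes s′ | no ¬s  = ⊥-elim (¬s (to (satClause-map D) s′))
  ... | no ¬s′ | yes s  = ⊥-elim (¬s′ (from (satClause-map D) s))

-- Monomials

evalMonomial-one : ∀ (α : Assignment n) → evalMonomial α oneᴹ ≡ 1ℤ
evalMonomial-one {ℕ.zero}  α = refl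
evalMonomial-one {ℕ.suc n} α = trans (ℤ.*-identityˡ _) (evalMonomial-one (α ∘ suc))

evalMonomial-var : ∀ (α : Assignment n) V → evalMonomial α (varᴹ V) ≡ α V
evalMonomial-var α zero = trans
  (cong₂ ℤ._*_ (ℤ.^-identityʳ (α zero)) (evalMonomial-one (α ∘ suc))) (ℤ.*-identityʳ _)
evalMonomial-var α (suc V) = trans (ℤ.*-identityˡ _) (evalMonomial-var (α ∘ suc) V)

evalMonomial-split : ∀ (α : Assignment n) Q V →
  evalMonomial α Q ≡ α V ℤ.^ lookup Q V ℤ.* evalMonomial α (Q [ V ]≔ 0)
evalMonomial-split α (e ∷ Q) zero    = cong (α zero ℤ.^ e ℤ.*_) (sym (ℤ.*-identityˡ _))
evalMonomial-split α (e ∷ Q) (suc V) = begin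
  x ℤ.* evalMonomial (α ∘ suc) Q ≡⟨ cong (x ℤ.*_) (evalMonomial-split (α ∘ suc) Q V) ⟩
  x ℤ.* (y ℤ.* z)                ≡⟨ ℤ.*-assoc x y z ⟨
  x ℤ.* y ℤ.* z                  ≡⟨ cong (ℤ._* z) (ℤ.*-comm x y) ⟩
  y ℤ.* x ℤ.* z                  ≡⟨ ℤ.*-assoc y x z ⟩
  y ℤ.* (x ℤ.* z)                ∎
  where
  open ≡-Reasoning
  x = α zero ℤ.^ e
  y = α (suc V) ℤ.^ lookup Q V
  z = evalMonomial (α ∘ suc) (Q [ V ]≔ 0)

degree-one : ∀ n → Vec.sum (oneᴹ {n}) ≡ 0
degree-one ℕ.zero    = refl
degree-one (ℕ.suc n) = degree-one n

degree-var : ∀ (V : Fin n) → Vec.sum (varᴹ V) ≡ 1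
degree-var {ℕ.suc n} zero    = cong ℕ.suc (degree-one n)
degree-var           (suc V) = degree-var V

-- This decrease drives the induction in `consistentBelow`.
degree-erase : ∀ (Q : Monomial n) V → 0 ℕ.< lookup Q V → Vec.sum (Q [ V ]≔ 0) ℕ.< Vec.sum Q
degree-erase (e ∷ Q) zero    0<e = ℕ.+-monoˡ-< (Vec.sum Q) 0<e
degree-erase (e ∷ Q) (suc V) 0<k = ℕ.+-monoʳ-< e (degree-erase Q V 0<k)

-- Domains

∈-range : ∀ {l u K} → l ℤ.≤ K → K ℤ.≤ u → K ∈ range l u
∈-range {l} {u} {K} l≤K K≤u with l ℤ.≤? u
... | no  l≰u = ⊥-elim (l≰u (ℤ.≤-trans l≤K K≤u))
... | yes l≤u = subst (_∈ _) l+∣K-l∣≡K (∈-map⁺ (λ i → l ℤ.+ + i) (∈-upTo⁺ (s≤s ∣K-l∣≤∣u-l∣)))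
  where
  K-l≡ : + ℤ.∣ K ℤ.- l ∣ ≡ K ℤ.- l
  K-l≡ = ℤ.0≤i⇒+∣i∣≡i (ℤ.i≤j⇒0≤j-i l≤K)
  u-l≡ : + ℤ.∣ u ℤ.- l ∣ ≡ u ℤ.- l
  u-l≡ = ℤ.0≤i⇒+∣i∣≡i (ℤ.i≤j⇒0≤j-i l≤u)
  ∣K-l∣≤∣u-l∣ : ℤ.∣ K ℤ.- l ∣ ≤ ℤ.∣ u ℤ.- l ∣
  ∣K-l∣≤∣u-l∣ = ℤ.drop‿+≤+ (subst₂ ℤ._≤_ (sym K-l≡) (sym u-l≡) (ℤ.+-monoˡ-≤ (ℤ.- l) K≤u))
  l+∣K-l∣≡K : l ℤ.+ + ℤ.∣ K ℤ.- l ∣ ≡ K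
  l+∣K-l∣≡K = begin
    l ℤ.+ + ℤ.∣ K ℤ.- l ∣ ≡⟨ cong (λ x → l ℤ.+ x) K-l≡ ⟩
    l ℤ.+ (K ℤ.- l)       ≡⟨ ℤ.+-comm l (K ℤ.- l) ⟩
    K ℤ.- l ℤ.+ l         ≡⟨ ℤ.+-assoc K (ℤ.- l) l ⟩
    K ℤ.+ (ℤ.- l ℤ.+ l)   ≡⟨ cong (λ x → K ℤ.+ x) (ℤ.+-inverseˡ l) ⟩
    K ℤ.+ 0ℤ              ≡⟨ ℤ.+-identityʳ K ⟩
    K                     ∎
    where open ≡-Reasoning

∈-lowers : ∀ (V : Fin n) {l} bs → lower V l ∈ bs → l ∈ lowers V bs
∈-lowers V (lower W L ∷ bs) (here refl) with V Fin.≟ V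
... | yes _  = here refl
... | no V≢V = ⊥-elim (V≢V refl)
∈-lowers V (lower W L ∷ bs) (there l∈) with V Fin.≟ W
... | yes _ = there (∈-lowers V bs l∈)
... | no _  = ∈-lowers V bs l∈
∈-lowers V (upper W U ∷ bs) (there l∈) = ∈-lowers V bs l∈

∈-uppers : ∀ (V : Fin n) {u} bs → upper V u ∈ bs → u ∈ uppers V bs
∈-uppers V (upper W U ∷ bs) (here refl) with V Fin.≟ V
... | yes _  = here refl
... | no V≢V = ⊥-elim (V≢V refl)
∈-uppers V (upper W U ∷ bs) (there u∈) with V Fin.≟ W
... | yes _ = there (∈-uppers V bs u∈)
... | no _  = ∈-uppers V bs u∈
∈-uppers V (lower W L ∷ bs) (there u∈) = ∈-uppers V bs u∈

lowers-sat : ∀ (α : Assignment n) V bs → All (SatBound α) bs → All (ℤ._≤ α V) (lowers V bs)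
lowers-sat α V []               []       = []
lowers-sat α V (lower W L ∷ bs) (s ∷ ss) with V Fin.≟ W
... | yes refl = s ∷ lowers-sat α V bs ss
... | no _     = lowers-sat α V bs ss
lowers-sat α V (upper W U ∷ bs) (s ∷ ss) = lowers-sat α V bs ss

uppers-sat : ∀ (α : Assignment n) V bs → All (SatBound α) bs → All (α V ℤ.≤_) (uppers V bs)
uppers-sat α V []               []       = []
uppers-sat α V (upper W U ∷ bs) (s ∷ ss) with V Fin.≟ W
... | yes refl = s ∷ uppers-sat α V bs ss
... | no _     = uppers-sat α V bs ss
uppers-sat α V (lower W L ∷ bs) (s ∷ ss) = uppers-sat α V bs ss

∈-filter : ∀ {P : ℤ → Set} (P? : Decidable P) xs {K} → K ∈ filter P? xs ⇔ (K ∈ xs × P K)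
∈-filter P? xs = mk⇔ (∈-filter⁻ P?) (λ (K∈ , p) → ∈-filter⁺ P? K∈ p)

-- The candidate list is local to the definition of domain and has no name here.
-- With filter abstracted to a variable, unification finds it.
domain-filter : ∀ bs (V : Fin n) → ∃[ xs ] ∀ {K} →
  K ∈ domain bs V ⇔ (K ∈ xs × All (ℤ._≤ K) (lowers V bs) × All (K ℤ.≤_) (uppers V bs))
domain-filter bs V
  with filter {P = λ K → All (ℤ._≤ K) (lowers V bs) × All (K ℤ.≤_) (uppers V bs)}
     | ∈-filter {P = λ K → All (ℤ._≤ K) (lowers V bs) × All (K ℤ.≤_) (uppers V bs)}
... | f | ∈-f = _ , ∈-f _ _

-- The candidates form the range between the first lower and the first upper bound. The memberships
-- of `l` and `u` rule out empty lists, and abstracting both lists lets `candidates` reduce.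
∈-candidates : ∀ bs (V : Fin n) {l u K} → l ∈ lowers V bs → u ∈ uppers V bs →
  All (ℤ._≤ K) (lowers V bs) → All (K ℤ.≤_) (uppers V bs) → K ∈ proj₁ (domain-filter bs V)
∈-candidates bs V l∈ u∈ ls≤K K≤us
  with lowers V bs | uppers V bs | l∈ | u∈ | ls≤K | K≤us
... | _ ∷ _ | _ ∷ _ | _ | _ | l≤K ∷ _ | K≤u ∷ _ = ∈-range l≤K K≤u

-- A linearization step splits over the range of one chosen pair of bounds, whereas relaxation
-- compares intersections of all bounds. Any such range contains the intersection.
domain⇒range : ∀ bs (V : Fin n) {l u K} → lower V l ∈ bs → upper V u ∈ bs →
  K ∈ domain bs V → K ∈ range l u
domain⇒range bs V l∈ u∈ K∈ with to (proj₂ (domain-filter bs V)) K∈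
... | _ , ls≤K , K≤us =
  ∈-range (All.lookup ls≤K (∈-lowers V bs l∈)) (All.lookup K≤us (∈-uppers V bs u∈))

Bounded : List (Bound n) → Fin n → Set
Bounded bs V = (∃[ l ] lower V l ∈ bs) × (∃[ u ] upper V u ∈ bs)

sat⇒∈-domain : ∀ (α : Assignment n) bs V → Bounded bs V → All (SatBound α) bs → α V ∈ domain bs V
sat⇒∈-domain α bs V ((l , l∈) , (u , u∈)) ss =
  from (proj₂ (domain-filter bs V))
    (∈-candidates bs V (∈-lowers V bs l∈) (∈-uppers V bs u∈) ls≤ ≤us , ls≤ , ≤us)
  where
  ls≤ = lowers-sat α V bs ss
  ≤us = uppers-sat α V bs ss

boundCost≡0⇒sat : ∀ (α : Assignment n) bs → boundCost bs α ≡ 0 → All (SatBound α) bs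
boundCost≡0⇒sat α bs cost≡0 = All.tabulate λ {b} b∈ → decidable-stable (satBound? α b) λ ¬s →
  length≡0⇒∉ cost≡0 (∈-filter⁺ (¬? ∘ satBound? α) (∈-deduplicate⁺ _≟ᴮ_ b∈) ¬s)
  where
  length≡0⇒∉ : ∀ {x : A} {xs} → length xs ≡ 0 → ¬ x ∈ xs
  length≡0⇒∉ {xs = []} _ ()

-- Relaxation of bounds

module _ (M : Assignment⁺ n) (Cs : List (Bound n)) where
  open DecMembership (_≟ᴮ_ {n}) using (_∈?_)

  relaxBounds-lower : ∀ {V l} bs → lower V l ∈ bs → ∃[ l′ ] lower V l′ ∈ relaxBounds M Cs bs
  relaxBounds-lower {V} {l} (_ ∷ bs) (here refl) with lower V l ∈? Cs
  ... | yes _ = _ , here refl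
  ... | no _  = _ , here refl
  relaxBounds-lower (_ ∷ bs) (there l∈) with relaxBounds-lower bs l∈
  ... | l′ , l′∈ = l′ , there l′∈

  relaxBounds-upper : ∀ {V u} bs → upper V u ∈ bs → ∃[ u′ ] upper V u′ ∈ relaxBounds M Cs bs
  relaxBounds-upper {V} {u} (_ ∷ bs) (here refl) with upper V u ∈? Cs
  ... | yes _ = _ , here refl
  ... | no _  = _ , here refl
  relaxBounds-upper (_ ∷ bs) (there u∈) with relaxBounds-upper bs u∈
  ... | u′ , u′∈ = u′ , there u′∈

  -- Relaxing changes the value of a bound but neither its variable nor its kind.
  relaxBounds-bounded : ∀ {V} B₀ B → Bounded (B₀ ++ B) V → Bounded (B₀ ++ relaxBounds M Cs B) V
  relaxBounds-bounded {V} B₀ B ((l , l∈) , (u , u∈)) = low (∈-++⁻ B₀ l∈) , upp (∈-++⁻ B₀ u∈)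
    where
    low : lower V l ∈ B₀ ⊎ lower V l ∈ B → ∃[ l′ ] lower V l′ ∈ B₀ ++ relaxBounds M Cs B
    low (inj₁ l∈) = l , ∈-++⁺ˡ l∈
    low (inj₂ l∈) with relaxBounds-lower B l∈
    ... | l′ , l′∈ = l′ , ∈-++⁺ʳ B₀ l′∈
    upp : upper V u ∈ B₀ ⊎ upper V u ∈ B → ∃[ u′ ] upper V u′ ∈ B₀ ++ relaxBounds M Cs B
    upp (inj₁ u∈) = u , ∈-++⁺ˡ u∈
    upp (inj₂ u∈) with relaxBounds-upper B u∈
    ... | u′ , u′∈ = u′ , ∈-++⁺ʳ B₀ u′∈

-- Case-splitting clauses

split : Monomial n → Fin n → ℕ → ℤ → Relop → Clause (Atom n)
split Q V v K r = lit ((1ℤ , inj₁ (varᴹ V)) ∷ []) `< ((K , inj₁ oneᴹ) ∷ [])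
                ∷ lit ((1ℤ , inj₁ (varᴹ V)) ∷ []) `> ((K , inj₁ oneᴹ) ∷ [])
                ∷ lit ((1ℤ , inj₂ v) ∷ []) r (evaluateAt Q V K) ∷ []

-- caseSplit T e K is definitionally map (mapClause (rename T)) (splits e K).
splits : Entry n → ℤ → List (Clause (Atom n))
splits (entry Q V v) K = split Q V v K `≤ ∷ split Q V v K `≥ ∷ []

evalPolynomial-evaluateAt : ∀ (w : Atom n → ℤ) Q V K →
  evalPolynomial w (evaluateAt Q V K) ≡ K ℤ.^ lookup Q V ℤ.* w (inj₁ (Q [ V ]≔ 0))
evalPolynomial-evaluateAt w Q V K with K ℤ.^ lookup Q V
-- `evaluateAt` drops the monomial when its coefficient vanishes, and the product vanishes too.
... | + 0         = sym (ℤ.*-zeroˡ (w (inj₁ (Q [ V ]≔ 0))))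
... | + ℕ.suc _   = ℤ.+-identityʳ _
... | -[1+ _ ]    = ℤ.+-identityʳ _

module _ (w : Atom n → ℤ) (w-one : w (inj₁ oneᴹ) ≡ 1ℤ)
         (Q : Monomial n) (V : Fin n) (v : ℕ) (K : ℤ) where
  private
    x = w (inj₁ (varᴹ V))
    x≡ : 1ℤ ℤ.* x ℤ.+ 0ℤ ≡ x
    x≡ = trans (ℤ.+-identityʳ _) (ℤ.*-identityˡ x)
    K≡ : K ℤ.* w (inj₁ oneᴹ) ℤ.+ 0ℤ ≡ K
    K≡ = trans (ℤ.+-identityʳ _) (trans (cong (K ℤ.*_) w-one) (ℤ.*-identityʳ K))
    v≡ : 1ℤ ℤ.* w (inj₂ v) ℤ.+ 0ℤ ≡ w (inj₂ v)
    v≡ = trans (ℤ.+-identityʳ _) (ℤ.*-identityˡ (w (inj₂ v)))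
    Q[V:=K] = K ℤ.^ lookup Q V ℤ.* w (inj₁ (Q [ V ]≔ 0))
    Q≡ : evalPolynomial w (evaluateAt Q V K) ≡ Q[V:=K]
    Q≡ = evalPolynomial-evaluateAt w Q V K

  -- With `x ≡ K` the two strict disjuncts fail, so both inequalities remain and antisymmetry
  -- applies. The valuation `w` is kept abstract because it will be an assignment read through a
  -- renaming.
  splits-elim : x ≡ K → SatAll w (splits (entry Q V v) K) → w (inj₂ v) ≡ Q[V:=K]
  splits-elim x≡K (s≤ ∷ s≥ ∷ []) = trans (sym v≡) (trans (ℤ.≤-antisym (third `≤ s≤) (third `≥ s≥)) Q≡)
    where
    third : ∀ r → SatClause w (split Q V v K r) →
      SatRelop w r (1ℤ ℤ.* w (inj₂ v) ℤ.+ 0ℤ) (evalPolynomial w (evaluateAt Q V K))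
    third r (here x<K)               = ⊥-elim (ℤ.<-irrefl (trans x≡ (trans x≡K (sym K≡))) x<K)
    third r (there (here K<x))       = ⊥-elim (ℤ.<-irrefl (sym (trans x≡ (trans x≡K (sym K≡)))) K<x)
    third r (there (there (here s))) = s

  splits-intro : (x ≡ K → w (inj₂ v) ≡ Q[V:=K]) → SatAll w (splits (entry Q V v) K)
  splits-intro v≡Q with ℤ.<-cmp x K
  ... | tri< x<K _ _ = here x<K′ ∷ here x<K′ ∷ []
    where x<K′ = subst₂ ℤ._<_ (sym x≡) (sym K≡) x<K
  ... | tri> _ _ K<x = there (here K<x′) ∷ there (here K<x′) ∷ []
    where K<x′ = subst₂ ℤ._<_ (sym K≡) (sym x≡) K<x
  ... | tri≈ _ x≡K _ = there (there (here (ℤ.≤-reflexive eq)))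
                     ∷ there (there (here (ℤ.≤-reflexive (sym eq)))) ∷ []
    where eq = trans v≡ (trans (v≡Q x≡K) (sym Q≡))

-- Renamings

-- A relation instead of the function `rename T`: it is monotone in the table, so it still describes
-- a clause after renamings by entries added later.
data Represents (T : List (Entry n)) : Atom n → Atom n → Set where
  same  : ∀ {a} → Represents T a a
  fresh : ∀ {Q V v} → entry Q V v ∈ T → Represents T (inj₁ Q) (inj₂ v)

Renaming : List (Entry n) → (Atom n → Atom n) → Set
Renaming T ρ = ∀ a → Represents T a (ρ a)

represents-mono : ∀ {T T′ : List (Entry n)} → (∀ {e} → e ∈ T → e ∈ T′) →
  ∀ {a a′} → Represents T a a′ → Represents T′ a a′
represents-mono T⊆T′ same       = same
represents-mono T⊆T′ (fresh e∈) = fresh (T⊆T′ e∈)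

rename-renaming : ∀ (T : List (Entry n)) → Renaming T (rename T)
rename-renaming []                (inj₁ Q) = same
rename-renaming []                (inj₂ v) = same
rename-renaming (_ ∷ T)           (inj₂ v) = same
rename-renaming (entry Q′ _ _ ∷ T) (inj₁ Q) with Q ≟ᴹ Q′
... | yes refl = fresh (here refl)
... | no _     = represents-mono there (rename-renaming T (inj₁ Q))

-- A fresh variable is fixed by all later renamings, so `e` acts only on atoms that are still
-- unchanged.
represents-step : ∀ {T} (e : Entry n) {a a′} →
  Represents T a a′ → Represents (e ∷ T) a (rename (e ∷ []) a′)
represents-step e same       =
  represents-mono (λ { (here eq) → here eq }) (rename-renaming (e ∷ []) _)
represents-step e (fresh e∈) = fresh (there e∈)

-- Consistent assignments

Correct : Assignment⁺ n → Entry n → Set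
Correct α (entry Q V v) = α (inj₂ v) ≡ evalMonomial (restrict α) Q

Consistent : Assignment⁺ n → List (Entry n) → Set
Consistent α = All (Correct α)

-- The induction hypothesis on degrees. For `d = 2` it concerns linear monomials only, and is
-- vacuous when all entries are non-linear.
ConsistentBelow : ℕ → Assignment⁺ n → List (Entry n) → Set
ConsistentBelow d α T = ∀ {e} → e ∈ T → Vec.sum (Entry.Q e) ℕ.< d → Correct α e

evalAtom-monomial : ∀ d (α : Assignment⁺ n) {T Q a} → ConsistentBelow d α T →
  Vec.sum Q ℕ.< d → Represents T (inj₁ Q) a → evalAtom α a ≡ evalMonomial (restrict α) Q
evalAtom-monomial d α c Q<d same       = refl
evalAtom-monomial d α c Q<d (fresh e∈) = c e∈ Q<d

evalAtom-renaming : ∀ (α : Assignment⁺ n) {T ρ} → Consistent α T → Renaming T ρ →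
  ∀ a → evalAtom α (ρ a) ≡ evalAtom α a
evalAtom-renaming α c ren a = go (ren a)
  where
  go : ∀ {a a′} → Represents _ a a′ → evalAtom α a′ ≡ evalAtom α a
  go same       = refl
  go (fresh e∈) = All.lookup c e∈

-- Invariants of linearization

-- Cs is stated before any renaming; ρ composes the renamings of all later steps.
Entails : List (Entry n) → (H Cs : List (Clause (Atom n))) → Set
Entails T H Cs = ∃[ ρ ] Renaming T ρ × (∀ w → SatAll w H → SatAll (w ∘ ρ) Cs)

-- A valuation satisfying the renamed clauses satisfies the old ones once composed with the
-- renaming. The composite need not come from an assignment, hence the quantification over all `w`
-- in `Entails`.
entails-rename : ∀ {T H Cs} (e : Entry n) H′ → Entails T H Cs →
  Entails (e ∷ T) (map (mapClause (rename (e ∷ []))) H ++ H′) Cs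
entails-rename {H = H} e H′ (ρ , ren , ent) =
  rename (e ∷ []) ∘ ρ , (λ a → represents-step e (ren a)) ,
  λ w s → ent (w ∘ rename (e ∷ [])) (to (satAll-map _ _ w (λ _ → refl) H) (All.++⁻ˡ _ s))

entails-++ : ∀ {T : List (Entry n)} {H Cs} H′ → Entails T H Cs → Entails T (H ++ H′) Cs
entails-++ H′ (ρ , ren , ent) = ρ , ren , λ w s → ent w (All.++⁻ˡ _ s)

caseSplit-entailed : ∀ T H (e : Entry n) K →
  (∀ w → SatAll w H → SatAll w (caseSplit T e K)) → Entails T H (splits e K)
caseSplit-entailed T H e K sat = rename T , rename-renaming T ,
  λ w s → to (satAll-map _ _ w (λ _ → refl) (splits e K)) (sat w s)

-- Factor the power of `V` out of `Q` and substitute `K` for `V`. This works for every `K`, so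
-- adding case splits never excludes a consistent assignment.
caseSplit-sat : ∀ (α : Assignment⁺ n) T e K → Consistent α T → Correct α e →
  SatAll (evalAtom α) (caseSplit T e K)
caseSplit-sat α T (entry Q V v) K c v≡Q =
  from (satAll-map (rename T) w w (evalAtom-renaming α c (rename-renaming T)) _)
       (splits-intro w (evalMonomial-one β) Q V v K λ var≡K → trans v≡Q (trans
         (evalMonomial-split β Q V)
         (cong (λ x → x ℤ.^ lookup Q V ℤ.* evalMonomial β (Q [ V ]≔ 0))
               (trans (sym (evalMonomial-var β V)) var≡K))))
  where
  β = restrict α
  w = evalAtom α

concatMap-lookup : ∀ {P : B → Set} (f : A → List B) {xs x} →
  All P (concatMap f xs) → x ∈ xs → All P (f x)
concatMap-lookup f ps x∈ = All.lookup (All.map⁻ (All.concat⁻ ps)) x∈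

concatMap-tabulate : ∀ {P : B → Set} (f : A → List B) xs →
  (∀ {x} → x ∈ xs → All P (f x)) → All P (concatMap f xs)
concatMap-tabulate f xs ps = All.concat⁺ (All.map⁺ (All.tabulate ps))

Usable : List (Bound n) → Entry n → Set
Usable bs (entry Q V v) = NonLinear Q × 0 ℕ.< lookup Q V × Bounded bs V

Extensible : List (Entry n) → Set
Extensible T = ∀ β → ∃[ g ] Consistent [ β , g ] T

Faithful : Formula n → Clauses n → Set
Faithful F cs = ∀ α → Consistent α (table cs) →
  (SatAll (evalAtom α) (hard cs) ⇔ Models (restrict α) F) × cost-S (soft cs) α ≡ cost F (restrict α)

-- `faithful` presupposes consistency, which must first be derived for a model given by the oracle.
-- `covered` and `hard₀-entailed` hold for all valuations and supply that derivation with the case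
-- splits and with the bounds stated in the input.
record Invariant (F : Formula n) (bs : List (Bound n)) (cs : Clauses n) : Set where
  field
    usable         : All (Usable bs) (table cs)
    covered        : ∀ {e K} → e ∈ table cs → K ∈ domain bs (Entry.V e) →
      Entails (table cs) (hard cs) (splits e K)
    hard₀-entailed : Entails (table cs) (hard cs) (map (mapClause inj₁) (hard₀ F))
    extensible     : Extensible (table cs)
    faithful       : Faithful F cs
open Invariant

initial-invariant : ∀ (F : Formula n) bs → Invariant F bs (initial F)
initial-invariant F bs = record
  { usable         = []
  ; covered        = λ ()
  ; hard₀-entailed = id , (λ _ → same) , λ _ s → s
  ; extensible     = λ _ → (λ _ → 0ℤ) , []
  ; faithful       = λ α _ →
      satAll-map inj₁ _ (evalAtom α) (λ _ → refl) (hard₀ F) ,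
      softCost-map inj₁ _ (evalAtom α) (λ _ → refl) (soft₀ F)
  }

-- Overriding `g` at `v` preserves the earlier entries, since none of them uses `v`.
extensible-step : ∀ {T} (e : Entry n) → ¬ Entry.v e ∈ map Entry.v T → Extensible T → Extensible (e ∷ T)
extensible-step {T = T} (entry Q V v) v∉T ext β with ext β
... | g , c = g′ , g′v≡ ∷ All.tabulate correct
  where
  g′ : ℕ → ℤ
  g′ v′ = if does (v′ ℕ.≟ v) then evalMonomial β Q else g v′
  g′v≡ : g′ v ≡ evalMonomial β Q
  g′v≡ rewrite dec-true (v ℕ.≟ v) refl = refl
  correct : ∀ {e} → e ∈ T → Correct [ β , g′ ] e
  correct {entry Q′ V′ v′} e∈
    rewrite dec-false (v′ ℕ.≟ v) (λ { refl → v∉T (∈-map⁺ Entry.v e∈) }) = All.lookup c e∈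

step-invariant : ∀ {F : Formula n} {bs s t} → bs ⊢ s ⟶ t → Invariant F bs s → Invariant F bs t
step-invariant {F = F} {bs} {s} (linearize Q V l u v nonlin _ 0<k l∈ u∈ v-fresh) inv = record
  { usable         = (nonlin , 0<k , (l , l∈) , (u , u∈)) ∷ usable inv
  ; covered        = covered′
  ; hard₀-entailed = entails-rename e splits′ (hard₀-entailed inv)
  ; extensible     = extensible-step e v-fresh (extensible inv)
  ; faithful       = faithful′
  }
  where
  e = entry Q V v
  T = e ∷ table s
  splits′ = concatMap (caseSplit T e) (range l u)
  H = map (mapClause (rename (e ∷ []))) (hard s) ++ splits′
  covered′ : ∀ {e′ K} → e′ ∈ T → K ∈ domain bs (Entry.V e′) → Entails T H (splits e′ K)
  covered′ {K = K} (here refl) K∈ = caseSplit-entailed T H e K λ w sat →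
    concatMap-lookup (caseSplit T e) (All.++⁻ʳ (map _ (hard s)) sat) (domain⇒range bs V l∈ u∈ K∈)
  covered′ (there e∈) K∈ = entails-rename e splits′ (covered inv e∈ K∈)
  faithful′ : Faithful F ⟨ T , H , map (mapSoft (rename (e ∷ []))) (soft s) ⟩
  faithful′ α (v≡Q ∷ c) =
    mk⇔ (λ sat → to hard⇔ (to renamed⇔ (All.++⁻ˡ _ sat)))
        (λ m → All.++⁺ (from renamed⇔ (from hard⇔ m))
          (concatMap-tabulate (caseSplit T e) (range l u)
             (λ {K} _ → caseSplit-sat α T e K (v≡Q ∷ c) v≡Q))) ,
    trans (softCost-map _ w w w≡ (soft s)) cost≡
    where
    w = evalAtom α
    w≡ : ∀ a → w (rename (e ∷ []) a) ≡ w a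
    w≡ = evalAtom-renaming α (v≡Q ∷ []) (rename-renaming (e ∷ []))
    hard⇔ = proj₁ (faithful inv α c)
    cost≡ = proj₂ (faithful inv α c)
    renamed⇔ = satAll-map _ w w w≡ (hard s)

steps-invariant : ∀ {F : Formula n} {bs s t} → Star (bs ⊢_⟶_) s t → Invariant F bs s → Invariant F bs t
steps-invariant ε              inv = inv
steps-invariant (step ◅ steps) inv = steps-invariant steps (step-invariant step inv)

-- A value in the domain for `bs′` either was in the old domain and is covered already, or is new
-- and gets its clauses now.
newCaseSplits-invariant : ∀ {F : Formula n} {bs} bs′ {cs} →
  (∀ {V} → Bounded bs V → Bounded bs′ V) → Invariant F bs cs →
  Invariant F bs′ ⟨ table cs , hard cs ++ newCaseSplits (table cs) bs bs′ , soft cs ⟩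
newCaseSplits-invariant {n = n} {F} {bs} bs′ {cs} bounded inv = record
  { usable         = All.map (λ (nonlin , 0<k , bnd) → nonlin , 0<k , bounded bnd) (usable inv)
  ; covered        = covered′
  ; hard₀-entailed = entails-++ H′ (hard₀-entailed inv)
  ; extensible     = extensible inv
  ; faithful       = faithful′
  }
  where
  open DecMembership ℤ._≟_ using (_∈?_; _∉?_)
  T = table cs
  H′ = newCaseSplits T bs bs′
  H = hard cs ++ H′
  newValues : Fin n → List ℤ
  newValues V = filter (_∉? domain bs V) (domain bs′ V)
  covered′ : ∀ {e K} → e ∈ T → K ∈ domain bs′ (Entry.V e) → Entails T H (splits e K)
  covered′ {e} {K} e∈ K∈′ with K ∈? domain bs (Entry.V e)
  ... | yes K∈ = entails-++ H′ (covered inv e∈ K∈)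
  ... | no  K∉ = caseSplit-entailed T H e K λ w sat →
    concatMap-lookup (caseSplit T e)
      (concatMap-lookup
        (λ e → concatMap (caseSplit T e) (newValues (Entry.V e)))
        (All.++⁻ʳ (hard cs) sat) e∈)
      (∈-filter⁺ (_∉? domain bs (Entry.V e)) K∈′ K∉)
  faithful′ : Faithful F ⟨ T , H , soft cs ⟩
  faithful′ α c with faithful inv α c
  ... | hard⇔ , cost≡ =
    mk⇔ (to hard⇔ ∘ All.++⁻ˡ _)
        (λ m → All.++⁺ (from hard⇔ m) (concatMap-tabulate _ T λ {e} e∈ →
          concatMap-tabulate _ (newValues (Entry.V e)) λ {K} _ →
            caseSplit-sat α T e K c (All.lookup c e∈))) ,
    cost≡

-- Consistency of models that respect the bounds

module _ {F : Formula n} {bs : List (Bound n)} {cs : Clauses n}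
         (inv : Invariant F bs cs) (α : Assignment⁺ n)
         (sat : SatAll (evalAtom α) (hard cs)) where

  -- The literal stating `b` is linear and all table entries are non-linear, so renaming cannot
  -- alter its value. Hence the input bounds hold before consistency is known, which avoids a
  -- circular argument.
  boundOf-sat : ∀ {b} → BoundOf F b → SatBound (restrict α) b
  boundOf-sat (ℓ , ℓ∈ , linear , ℓ⇔b) with hard₀-entailed inv
  ... | ρ , ren , ent with All.lookup (ent (evalAtom α) sat) (∈-map⁺ (mapClause inj₁) ℓ∈)
  ...   | here ℓ-sat = to (ℓ⇔b (restrict α)) (to (satLiteral-map inj₁ _ _ ℓ λ Q occ →
            evalAtom-monomial 2 α linear-consistent (ℕ.≰⇒> (λ nonlin → linear Q nonlin occ))
                              (ren (inj₁ Q))) ℓ-sat)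
    where
    linear-consistent : ConsistentBelow 2 α (table cs)
    linear-consistent e∈ Q<2 = ⊥-elim (ℕ.<⇒≱ Q<2 (proj₁ (All.lookup (usable inv) e∈)))

  -- Induction on `d`. As `α` respects the bounds, the value of `V` is in its domain and the split
  -- there is entailed. The monomial left after erasing `V` may itself be renamed, and the induction
  -- hypothesis gives its value.
  consistentBelow : All (SatBound (restrict α)) bs → ∀ d → ConsistentBelow d α (table cs)
  consistentBelow bs-sat (ℕ.suc d) {entry Q V v} e∈ (s≤s Q≤d)
    with All.lookup (usable inv) e∈
  ... | nonlin , 0<k , bnd
    with covered inv e∈ (sat⇒∈-domain (restrict α) bs V bnd bs-sat)
  ... | ρ , ren , ent = begin
    α (inj₂ v)                       ≡⟨ evalAtom-fresh (ren (inj₂ v)) ⟨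
    w (inj₂ v)                       ≡⟨ splits-elim w w-one Q V v (β V) w-var (ent (evalAtom α) sat) ⟩
    c ℤ.* w (inj₁ (Q [ V ]≔ 0))      ≡⟨ cong (c ℤ.*_) (w-below (degree-erase Q V 0<k)) ⟩
    c ℤ.* evalMonomial β (Q [ V ]≔ 0) ≡⟨ evalMonomial-split β Q V ⟨
    evalMonomial β Q                 ∎
    where
    open ≡-Reasoning
    β = restrict α
    w = evalAtom α ∘ ρ
    c = β V ℤ.^ lookup Q V
    w-below : ∀ {R} → Vec.sum R ℕ.< Vec.sum Q → w (inj₁ R) ≡ evalMonomial β R
    w-below R<Q = evalAtom-monomial d α (consistentBelow bs-sat d) (ℕ.<-≤-trans R<Q Q≤d) (ren _)
    evalAtom-fresh : ∀ {a} → Represents (table cs) (inj₂ v) a → evalAtom α a ≡ α (inj₂ v)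
    evalAtom-fresh same = refl
    -- The constant and the variable also pass through `ρ`; their degrees 0 and 1 lie below that of
    -- the non-linear `Q`, so the induction hypothesis applies to them.
    w-one : w (inj₁ oneᴹ) ≡ 1ℤ
    w-one = trans (w-below (subst (ℕ._< Vec.sum Q) (sym (degree-one n)) (ℕ.<-trans ℕ.z<s nonlin)))
                  (evalMonomial-one β)
    w-var : w (inj₁ (varᴹ V)) ≡ β V
    w-var = trans (w-below (subst (ℕ._< Vec.sum Q) (sym (degree-var V)) nonlin)) (evalMonomial-var β V)

  consistent : All (SatBound (restrict α)) bs → Consistent α (table cs)
  consistent bs-sat = All.tabulate λ {e} e∈ →
    consistentBelow bs-sat (ℕ.suc (Vec.sum (Entry.Q e))) e∈ ℕ.≤-refl

-- The loop

-- The threshold is expressed by the cost in the input formula, so it stays valid when relaxation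
-- rewrites the soft clauses.
BestSoFar : Formula n → Maybe (Assignment⁺ n) → Threshold → Set
BestSoFar F nothing  msc = msc ≡ ∞
BestSoFar F (just M) msc = Models (restrict M) F × msc ≡ finite (+ cost F (restrict M) ℤ.- 1ℤ)

StateInvariant : Formula n → List (Bound n) → State n → Set
StateInvariant F B₀ (state cs B bsf msc) = Invariant F (B₀ ++ B) cs × BestSoFar F bsf msc

loop-invariant : ∀ {F : Formula n} {B₀ σ τ} → All (BoundOf F) B₀ →
  Star (B₀ ⊢_⇝_) σ τ → StateInvariant F B₀ σ → StateInvariant F B₀ τ
loop-invariant B₀-bounds ε inv = inv
loop-invariant {B₀ = B₀} B₀-bounds (improve {cs} {B} M ((sat , _) , _) cost≡0 ◅ rest) (inv , _) =
  loop-invariant B₀-bounds rest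
    (inv , to (proj₁ fth) sat , cong (λ c → finite (+ c ℤ.- 1ℤ)) (proj₂ fth))
  where
  bs-sat : All (SatBound (restrict M)) (B₀ ++ B)
  -- The input bounds follow from the hard clauses, the artificial ones from bound cost 0.
  bs-sat = All.++⁺ (All.map (boundOf-sat inv M sat) B₀-bounds) (boundCost≡0⇒sat (restrict M) B cost≡0)
  fth = faithful inv M (consistent inv M sat bs-sat)
loop-invariant {B₀ = B₀} B₀-bounds (relax {B = B} M Cs _ _ _ _ _ (steps , _) ◅ rest) (inv , best) =
  loop-invariant B₀-bounds rest
    (steps-invariant steps
       (newCaseSplits-invariant _ (relaxBounds-bounded M Cs B₀ B) inv) , best)

run-invariant : ∀ {F : Formula n} {r} (run : SolveMaxSMT F r) →
  StateInvariant F (SolveMaxSMT.B₀ run) (SolveMaxSMT.final run)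
run-invariant {F = F} run = loop-invariant B₀-bounds loop
  (steps-invariant (proj₁ linearizes) (initial-invariant F _) , refl)
  where open SolveMaxSMT run

-- Soundness of the answers

model⇒candidate : ∀ {F : Formula n} {bs cs} msc → Invariant F bs cs → ∀ β → Models β F →
  cost F β ≤ᵀ msc → ∃[ α ] SatAll (evalAtom α) (hard cs) × cost-S (soft cs) α ≤ᵀ msc
model⇒candidate msc inv β m cost≤ with extensible inv β
... | g , c with faithful inv [ β , g ] c
... | hard⇔ , cost≡ = [ β , g ] , from hard⇔ m , subst (_≤ᵀ msc) (sym cost≡) cost≤

sat-optimal : ∀ {F : Formula n} {B₀ σ M} → StateInvariant F B₀ σ → Returns σ (Sat , just M) →
  Models (restrict M) F × (∀ β → Models β F → cost F (restrict M) ≤ cost F β)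
sat-optimal (inv , m , refl) (return-sat no-candidate) = m , λ β mβ →
  ℕ.≮⇒≥ λ β<M → no-candidate (model⇒candidate _ inv β mβ (<⇒≤pred β<M))
  where
  -- Matching on `s≤s` exposes `b` as a successor, so the integer `+ b - 1` computes to a natural
  -- number. The threshold -1 arises only for `b = 0`, where no smaller cost exists.
  <⇒≤pred : ∀ {a b} → a ℕ.< b → + a ℤ.≤ + b ℤ.- 1ℤ
  <⇒≤pred (s≤s a≤b) = ℤ.+≤+ a≤b

unsat-sound : ∀ {F : Formula n} {B₀ σ} → StateInvariant F B₀ σ → Returns σ (Unsat , nothing) →
  ¬ Satisfiable F
unsat-sound (inv , refl) (return-unsat no-candidate) (β , m) =
  no-candidate (model⇒candidate ∞ inv β m tt)

theorem4p1 : ∀ (n : ℕ) (F : Formula n) →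
    (∀ (M : Assignment⁺ n) → SolveMaxSMT F (Sat , just M) →
    Satisfiable F
    × Models (restrict M) F
    × (∀ (β : Assignment n) → Models β F → cost F (restrict M) ≤ cost F β))
    × (SolveMaxSMT F (Unsat , nothing) → ¬ Satisfiable F)
theorem4p1 n F =
  (λ M run → let (m , optimal) = sat-optimal (run-invariant run) (SolveMaxSMT.returns run)
             in (restrict M , m) , m , optimal) ,
  (λ run → unsat-sound (run-invariant run) (SolveMaxSMT.returns run))
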